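{- Let $n$ be a positive integer, let $d(n)$ be the number of positive divisors of $n$, and let $d_{2,4}(n)$ be the number of positive divisors of $n$ congruent to $2$ modulo $4$. Then \[ d(n) - 4d_{2, 4}(n) = \sum_{\pi \in \mathcal{P}^{\ast}(n)} (-1)^{\#(\pi) - 1} \omega(\pi), \qquad\text{where}\qquad \omega(\pi) := \nu(\ell(\pi))\prod_{i=1}^{\ell(\pi) - 1} \big(2\nu(i) - 1\big). \]
   Context: $\mathcal{P}^{\ast}(n)$ is the set of partitions of $n$ whose set of distinct parts is exactly $\{1,2,\dots,\ell(\pi)\}$ (i.e. every integer from $1$ to the largest part occurs at least once). For a partition $\pi$, $\ell(\pi)$ is its largest part, $\#(\pi)$ its number of parts, and $\nu(j)$ the number of times the integer $j$ occurs as a part of $\pi$. -}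

module Defs where

open import Data.Nat using (ℕ; zero; suc; _+_; _∸_; _⊔_; _⊓_; _≟_; _%_)
open import Data.Nat.Divisibility using (_∣?_)
open import Data.Integer as ℤ using (ℤ; +_; -_)
open import Data.List using (List; []; _∷_; [_]; map; concatMap; filter; length; foldr; applyUpTo)
open import Data.List.Membership.DecPropositional _≟_ using (_∈?_)
open import Data.List.Relation.Unary.All using (All; all?)
open import Data.List.Membership.Propositional using (_∈_)
open import Relation.Nullary.Decidable using (Dec; _×-dec_)
open import Data.Product using (_×_)
open import Relation.Binary.PropositionalEquality using (_≡_)

range : ℕ → ℕ → List ℕ
range a b = applyUpTo (λ i → a + i) (suc b ∸ a)

-- Partitions.  A partition of n is represented by the list of its parts
-- in non-increasing order (all parts positive, summing to n).
-- partsF fuel m n : all partitions of n with every part ≤ m, listed as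
-- non-increasing lists; fuel ≥ n suffices (each part is ≥ 1).

partsF : ℕ → ℕ → ℕ → List (List ℕ)
partsF _       m zero    = [ [] ]
partsF zero    m (suc n) = []
partsF (suc f) m (suc n) =
  concatMap (λ k → map (k ∷_) (partsF f k (suc n ∸ k))) (range 1 (m ⊓ suc n))

partitions : ℕ → List (List ℕ)
partitions n = partsF n n n

largest : List ℕ → ℕ
largest = foldr _⊔_ 0

numParts : List ℕ → ℕ
numParts = length

mult : List ℕ → ℕ → ℕ
mult π j = length (filter (j ≟_) π)

-- π ∈ P*: every integer 1, ..., ℓ(π) occurs as a part (parts are positive
-- and ≤ ℓ(π) by construction, so the set of distinct parts is {1..ℓ(π)})
IsPStar : List ℕ → Set
IsPStar π = All (_∈ π) (range 1 (largest π))

isPStar? : (π : List ℕ) → Dec (IsPStar π)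
isPStar? π = all? (_∈? π) (range 1 (largest π))

pStar : ℕ → List (List ℕ)
pStar n = filter isPStar? (partitions n)

d : ℕ → ℕ
d n = length (filter (_∣? n) (range 1 n))

d24 : ℕ → ℕ
d24 n = length (filter (λ k → (k ∣? n) ×-dec (k % 4 ≟ 2)) (range 1 n))

sumℤ : List ℤ → ℤ
sumℤ = foldr ℤ._+_ (+ 0)

productℤ : List ℤ → ℤ
productℤ = foldr ℤ._*_ (+ 1)

ω : List ℕ → ℤ
ω π = (+ mult π (largest π)) ℤ.*
      productℤ (map (λ i → (+ (2 Data.Nat.* mult π i)) ℤ.- (+ 1)) (range 1 (largest π ∸ 1)))

signedWeight : List ℕ → ℤ
signedWeight π = ((- (+ 1)) ℤ.^ (numParts π ∸ 1)) ℤ.* ω π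

{-# OPTIONS --safe #-}

-- Summing over the multiplicities of the parts turns the right-hand side into
--   ∑ₙ (-1)ⁿ⁻¹ q^(n(n+1)/2) (q)ₙ₋₁ / (-q)ₙ²,
-- the case x = y = -1 of
--   ∑ₙ (-1)ⁿ⁻¹ q^(n(n+1)/2) (q)ₙ₋₁ (xy)ⁿ / ((xq)ₙ (yq)ₙ) = ∑_{r,s ≥ 1} xʳ yˢ q^(rs).
-- Calling the left-hand side H(y), the terms of H(y) - x H(yq) telescope to xyq / (1 - yq).  With
-- x = -1 and y = -qʲ, iterating over j gives ∑ⱼ (-1)ʲ q^(j+1) / (1 + q^(j+1)), whose n-th coefficient
-- is the sum of (-1)^(r+s) over rs = n, and this is d(n) - 4 d₂,₄(n).
module Submission where

open import Defs
open import Algebra.Bundles using (CommutativeRing)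
open import Algebra.Construct.Pointwise using (isAbelianGroup)
import Algebra.Solver.Ring as RingSolver
open import Algebra.Solver.Ring.AlmostCommutativeRing using (fromCommutativeRing; _-Raw-AlmostCommutative⟶_)
open import Data.Bool using (Bool; true; false; if_then_else_; _∧_)
open import Data.Bool.Properties using (∧-zeroʳ; ∧-identityʳ)
open import Data.Integer as ℤ using (ℤ; +_; 0ℤ; 1ℤ; -1ℤ)
open import Data.Integer.Tactic.RingSolver using (solve-∀)
import Data.Integer.Properties as ℤ
open import Data.List using (List; []; _∷_; _++_; _∷ʳ_; map; concatMap; length; filter; applyUpTo)
open import Data.List.Membership.Propositional using (_∈_; _∉_)
open import Data.List.Properties
  using (map-++; map-∘; concatMap-++; ++-identityʳ; applyUpTo-∷ʳ; map-cong-local;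
         filter-accept; filter-reject; filter-some; filter-none)
open import Data.List.Relation.Unary.All as All using (All; []; _∷_; all?)
import Data.List.Relation.Unary.All.Properties as All
open import Data.List.Relation.Unary.Any using (here)
open import Data.Maybe using (Maybe; just; nothing)
open import Data.Nat as ℕ using (ℕ; zero; suc; NonZero)
open import Data.Nat.Divisibility using (_∣?_; ∣m∣n⇒∣m+n; ∣m+n∣m⇒∣n; ∣-refl; >⇒∤; _∣0)
import Data.Nat.Properties as ℕ
open import Data.List.Membership.DecPropositional ℕ._≟_ using (_∈?_)
open import Data.Product using (_,_)
open import Function using (_∘_; const; mk⇔)
open import Level using (0ℓ)
open import Relation.Binary.Consequences using (dec⇒weaklyDec)
open import Relation.Binary.PropositionalEquality
  using (_≡_; refl; sym; trans; cong; cong₂; subst; module ≡-Reasoning)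
open import Relation.Nullary using (¬_; contradiction)
open import Relation.Nullary.Decidable using (Dec; yes; no; does; dec-true; dec-false; does-⇔; _×-dec_)
open import Relation.Unary using (Decidable)

-- Formal power series over ℤ

-- The closing count comes from (-1)^(r+s) = (1 - 2[2 ∣ r]) (1 - 2[2 ∣ s]): for rs = n, s is even
-- exactly when 2r ∣ n, so the sum involves only the numbers of divisors of n that are multiples of
-- 1, 2 and 4. The parameter y is kept free along -qʲ because the telescoping links y with yq; only
-- j = 0 is wanted in the end. Neither limits nor division are used. Infinite sums are cut off in a
-- fixed degree n, where the omitted terms vanish. Denominators become explicit geometric series,
-- and since the ring solver knows no inverses, each cancellation first exposes a factor `1#`, or a
-- product equal to it, which is then exchanged by hand. On the partition side, membership in P* is
-- turned into a weight that vanishes on all other partitions, so that the multiplicity of each part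
-- can be summed on its own.

Series : Set
Series = ℕ → ℤ

constant : ℤ → Series
constant a zero    = a
constant a (suc n) = 0ℤ

infixl 7 _⊛_

-- Cauchy product, computed by f g = f₀ g + X (tail f) g.
_⊛_ : Series → Series → Series
(f ⊛ g) zero    = f 0 ℤ.* g 0
(f ⊛ g) (suc n) = f 0 ℤ.* g (suc n) ℤ.+ (f ∘ suc ⊛ g) n

⊛-cong : ∀ {f f′ g g′} → (∀ n → f n ≡ f′ n) → (∀ n → g n ≡ g′ n) → ∀ n → (f ⊛ g) n ≡ (f′ ⊛ g′) n
⊛-cong f≈ g≈ zero    = cong₂ ℤ._*_ (f≈ 0) (g≈ 0)
⊛-cong f≈ g≈ (suc n) = cong₂ ℤ._+_ (cong₂ ℤ._*_ (f≈ 0) (g≈ (suc n))) (⊛-cong (f≈ ∘ suc) g≈ n)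

-- Mirror image of the defining recursion, with the last term of the convolution split off;
-- commutativity is the exchange of the two.
⊛-sucʳ : ∀ f g n → (f ⊛ g) (suc n) ≡ (f ⊛ (g ∘ suc)) n ℤ.+ f (suc n) ℤ.* g 0
⊛-sucʳ f g zero    = refl
⊛-sucʳ f g (suc n) = begin
  f 0 ℤ.* g (2 ℕ.+ n) ℤ.+ (f ∘ suc ⊛ g) (suc n)
    ≡⟨ cong (λ c → f 0 ℤ.* g (2 ℕ.+ n) ℤ.+ c) (⊛-sucʳ (f ∘ suc) g n) ⟩
  f 0 ℤ.* g (2 ℕ.+ n) ℤ.+ ((f ∘ suc ⊛ (g ∘ suc)) n ℤ.+ f (2 ℕ.+ n) ℤ.* g 0)
    ≡⟨ ℤ.+-assoc (f 0 ℤ.* g (2 ℕ.+ n)) _ _ ⟨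
  (f ⊛ (g ∘ suc)) (suc n) ℤ.+ f (2 ℕ.+ n) ℤ.* g 0 ∎
  where open ≡-Reasoning

⊛-comm : ∀ f g n → (f ⊛ g) n ≡ (g ⊛ f) n
⊛-comm f g zero    = ℤ.*-comm (f 0) (g 0)
⊛-comm f g (suc n) = begin
  f 0 ℤ.* g (suc n) ℤ.+ (f ∘ suc ⊛ g) n
    ≡⟨ cong₂ ℤ._+_ (ℤ.*-comm (f 0) (g (suc n))) (⊛-comm (f ∘ suc) g n) ⟩
  g (suc n) ℤ.* f 0 ℤ.+ (g ⊛ (f ∘ suc)) n
    ≡⟨ ℤ.+-comm (g (suc n) ℤ.* f 0) _ ⟩
  (g ⊛ (f ∘ suc)) n ℤ.+ g (suc n) ℤ.* f 0
    ≡⟨ ⊛-sucʳ g f n ⟨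
  (g ⊛ f) (suc n) ∎
  where open ≡-Reasoning

⊛-distribʳ : ∀ h f g n → ((λ i → f i ℤ.+ g i) ⊛ h) n ≡ (f ⊛ h) n ℤ.+ (g ⊛ h) n
⊛-distribʳ h f g zero    = ℤ.*-distribʳ-+ (h 0) (f 0) (g 0)
⊛-distribʳ h f g (suc n)
  rewrite ⊛-distribʳ h (f ∘ suc) (g ∘ suc) n = lemma (f 0) (g 0) (h (suc n)) _ _
  where
  lemma : ∀ a b c x y → (a ℤ.+ b) ℤ.* c ℤ.+ (x ℤ.+ y) ≡ (a ℤ.* c ℤ.+ x) ℤ.+ (b ℤ.* c ℤ.+ y)
  lemma = solve-∀

⊛-distribˡ : ∀ f g h n → (f ⊛ (λ i → g i ℤ.+ h i)) n ≡ (f ⊛ g) n ℤ.+ (f ⊛ h) n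
⊛-distribˡ f g h n = begin
  (f ⊛ (λ i → g i ℤ.+ h i)) n   ≡⟨ ⊛-comm f _ n ⟩
  ((λ i → g i ℤ.+ h i) ⊛ f) n   ≡⟨ ⊛-distribʳ f g h n ⟩
  (g ⊛ f) n ℤ.+ (h ⊛ f) n       ≡⟨ cong₂ ℤ._+_ (⊛-comm g f n) (⊛-comm h f n) ⟩
  (f ⊛ g) n ℤ.+ (f ⊛ h) n       ∎
  where open ≡-Reasoning

⊛-scaleˡ : ∀ a f g n → ((λ i → a ℤ.* f i) ⊛ g) n ≡ a ℤ.* (f ⊛ g) n
⊛-scaleˡ a f g zero    = ℤ.*-assoc a (f 0) (g 0)
⊛-scaleˡ a f g (suc n)
  rewrite ⊛-scaleˡ a (f ∘ suc) g n = lemma a (f 0) (g (suc n)) _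
  where
  lemma : ∀ a b c x → a ℤ.* b ℤ.* c ℤ.+ a ℤ.* x ≡ a ℤ.* (b ℤ.* c ℤ.+ x)
  lemma = solve-∀

⊛-assoc : ∀ f g h n → ((f ⊛ g) ⊛ h) n ≡ (f ⊛ (g ⊛ h)) n
⊛-assoc f g h zero    = ℤ.*-assoc (f 0) (g 0) (h 0)
⊛-assoc f g h (suc n)
  -- The tail of `f ⊛ g` is by definition `f 0` times the tail of `g` plus `f ∘ suc ⊛ g`.
  rewrite ⊛-distribʳ h (λ i → f 0 ℤ.* g (suc i)) (f ∘ suc ⊛ g) n
        | ⊛-scaleˡ (f 0) (g ∘ suc) h n
        | ⊛-assoc (f ∘ suc) g h n
  = lemma (f 0) (g 0) (h (suc n)) _ _
  where
  lemma : ∀ a b c x y → a ℤ.* b ℤ.* c ℤ.+ (a ℤ.* x ℤ.+ y) ≡ a ℤ.* (b ℤ.* c ℤ.+ x) ℤ.+ y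
  lemma = solve-∀

⊛-zeroˡ : ∀ f n → ((λ _ → 0ℤ) ⊛ f) n ≡ 0ℤ
⊛-zeroˡ f zero    = refl
⊛-zeroˡ f (suc n) = trans (ℤ.+-identityˡ _) (⊛-zeroˡ f n)

⊛-constantˡ : ∀ a f n → (constant a ⊛ f) n ≡ a ℤ.* f n
⊛-constantˡ a f zero    = refl
⊛-constantˡ a f (suc n) = trans (cong (λ c → a ℤ.* f (suc n) ℤ.+ c) (⊛-zeroˡ f n)) (ℤ.+-identityʳ _)

⊛-identityˡ : ∀ f n → (constant 1ℤ ⊛ f) n ≡ f n
⊛-identityˡ f n = trans (⊛-constantˡ 1ℤ f n) (ℤ.*-identityˡ (f n))

seriesRing : CommutativeRing 0ℓ 0ℓ
seriesRing = record
  { Carrier = Series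
  ; _≈_     = λ f g → ∀ n → f n ≡ g n
  ; _+_     = λ f g n → f n ℤ.+ g n
  ; _*_     = _⊛_
  ; -_      = λ f n → ℤ.- f n
  ; 0#      = λ _ → 0ℤ
  ; 1#      = constant 1ℤ
  ; isCommutativeRing = record
    { isRing = record
      { +-isAbelianGroup = isAbelianGroup ℕ ℤ.+-0-isAbelianGroup
      ; *-cong           = ⊛-cong
      ; *-assoc          = ⊛-assoc
      ; *-identity       = ⊛-identityˡ , λ f n → trans (⊛-comm f _ n) (⊛-identityˡ f n)
      ; distrib          = ⊛-distribˡ , ⊛-distribʳ
      }
    ; *-comm = ⊛-comm
    }
  }

open CommutativeRing seriesRing
  using (_≈_; _+_; _*_; -_; _-_; 1#; setoid; +-cong; +-congˡ; +-congʳ; *-cong; *-congˡ; *-congʳ; -‿cong)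
  renaming (refl to ≈-refl; sym to ≈-sym; trans to ≈-trans)

-- Embedding the integers as coefficients lets the solver compute with numerals such as `con (+ 2)`.
constantMorphism : CommutativeRing.rawRing ℤ.+-*-commutativeRing
                   -Raw-AlmostCommutative⟶ fromCommutativeRing seriesRing
constantMorphism = record
  { ⟦_⟧    = constant
  ; +-homo = λ { a b zero → refl ; a b (suc n) → refl }
  ; *-homo = λ { a b zero → refl
               ; a b (suc n) → sym (trans (⊛-constantˡ a (constant b) (suc n)) (ℤ.*-zeroʳ a)) }
  ; -‿homo = λ { a zero → refl ; a (suc n) → refl }
  ; 0-homo = λ { zero → refl ; (suc n) → refl }
  ; 1-homo = λ n → refl
  }

constant-≟ : ∀ a b → Maybe (constant a ≈ constant b)
constant-≟ a b with dec⇒weaklyDec ℤ._≟_ a b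
... | just a≡b = just (λ n → cong (λ c → constant c n) a≡b)
... | nothing  = nothing

open RingSolver _ (fromCommutativeRing seriesRing) constantMorphism constant-≟
  using (solve; _:=_; _:+_; _:*_; _:-_; :-_; con)
import Relation.Binary.Reasoning.Setoid setoid as ≈-Reasoning

-- The q-series identity

X : Series
X zero    = 0ℤ
X (suc n) = constant 1ℤ n

q^ : ℕ → Series
q^ zero    = 1#
q^ (suc k) = X * q^ k

q^-+ : ∀ j k → q^ (j ℕ.+ k) ≈ q^ j * q^ k
q^-+ zero    k = ≈-sym (⊛-identityˡ (q^ k))
q^-+ (suc j) k = ≈-trans (*-congˡ {X} (q^-+ j k)) (≈-sym (⊛-assoc X (q^ j) (q^ k)))

X*-suc : ∀ f n → (X * f) (suc n) ≡ f n
X*-suc f n = trans (ℤ.+-identityˡ _) (⊛-identityˡ f n)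

q^*-+ : ∀ k f n → (q^ k * f) (k ℕ.+ n) ≡ f n
q^*-+ zero    f n = ⊛-identityˡ f n
q^*-+ (suc k) f n =
  trans (⊛-assoc X (q^ k) f (suc (k ℕ.+ n)))
        (trans (X*-suc (q^ k * f) (k ℕ.+ n)) (q^*-+ k f n))

q^*-< : ∀ {k n} f → n ℕ.< k → (q^ k * f) n ≡ 0ℤ
q^*-< {suc k} {zero}  f _         = ⊛-assoc X (q^ k) f 0
q^*-< {suc k} {suc n} f (ℕ.s≤s n<k) =
  trans (⊛-assoc X (q^ k) f (suc n)) (trans (X*-suc (q^ k * f) n) (q^*-< f n<k))

-- Geometric series

bit : Bool → ℤ
bit b = if b then 1ℤ else 0ℤ

-- The series 1 / (1 - qᵏ) for k ≥ 1. Written as a divisibility test, its coefficients are already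
-- the summands of a divisor count.
ι : ℕ → Series
ι k n = bit (does (k ∣? n))

ι-> : ∀ {k} n .{{_ : NonZero n}} → n ℕ.< k → ι k n ≡ 0ℤ
ι-> {k} n n<k = cong bit (dec-false (k ∣? n) (>⇒∤ n<k))

ι-+ : ∀ k n → ι k (k ℕ.+ n) ≡ ι k n
ι-+ k n = cong bit (does-⇔ (mk⇔ (λ d → ∣m+n∣m⇒∣n d ∣-refl) (∣m∣n⇒∣m+n ∣-refl)) (k ∣? (k ℕ.+ n)) (k ∣? n))

-- Multiplication by 1 - qᵏ subtracts the copy shifted by `k`: from degree `k` on, periodicity
-- cancels everything, and below `k` only 0 is a multiple of `k`.
ι-inverse : ∀ k .{{_ : NonZero k}} → (1# - q^ k) * ι k ≈ 1#
ι-inverse k@(suc _) n = trans (expand n) (coefficient n)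
  where
  expand : (1# - q^ k) * ι k ≈ ι k - q^ k * ι k
  expand = solve 2 (λ x i → (con 1ℤ :- x) :* i := i :- x :* i) ≈-refl (q^ k) (ι k)

  small : ∀ n → n ℕ.< k → ι k n ≡ 1# n
  small zero    _   = cong bit (dec-true (k ∣? 0) (k ∣0))
  small (suc n) n<k = ι-> (suc n) n<k

  coefficient : ∀ n → (ι k - q^ k * ι k) n ≡ 1# n
  coefficient n with n ℕ.<? k
  ... | yes n<k rewrite q^*-< (ι k) n<k = trans (ℤ.+-identityʳ (ι k n)) (small n n<k)
  ... | no n≮k with ℕ.m≤n⇒∃[o]m+o≡n (ℕ.≮⇒≥ n≮k)
  ...   | m , refl rewrite q^*-+ k (ι k) m | ι-+ k m = ℤ.+-inverseʳ (ι k m)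

-- The geometric series 1 / (1 + qᵏ), from 1 / (1 + x) = 2 / (1 - x²) - 1 / (1 - x).
e : ℕ → Series
e k = ι (k ℕ.* 2) + ι (k ℕ.* 2) - ι k

e-inverse : ∀ k .{{_ : NonZero k}} → (1# + q^ k) * e k ≈ 1#
e-inverse k@(suc _) = begin
  (1# + x) * (b + b - a)
    ≈⟨ solve 3 (λ x a b → (con 1ℤ :+ x) :* (b :+ b :- a)
                  := (con (+ 2) :* ((con 1ℤ :+ x) :* b) :- (con 1ℤ :+ x) :* a) :* con 1ℤ) ≈-refl x a b ⟩
  (c * ((1# + x) * b) - (1# + x) * a) * 1#
    -- The inserted 1 = (1 - x) a supplies the factor that completes 1 + x to 1 - x², which `b`
    -- inverts.
    ≈⟨ *-congˡ {c * ((1# + x) * b) - (1# + x) * a} (ι-inverse k) ⟨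
  (c * ((1# + x) * b) - (1# + x) * a) * ((1# - x) * a)
    ≈⟨ solve 3 (λ x a b → (con (+ 2) :* ((con 1ℤ :+ x) :* b) :- (con 1ℤ :+ x) :* a) :* ((con 1ℤ :- x) :* a)
                  := (con (+ 2) :* ((con 1ℤ :- x :* x) :* b) :- (con 1ℤ :+ x) :* ((con 1ℤ :- x) :* a)) :* a)
             ≈-refl x a b ⟩
  (c * ((1# - x * x) * b) - (1# + x) * ((1# - x) * a)) * a
    ≈⟨ *-congʳ {a} (+-cong (*-congˡ {c} xxb≈1) (-‿cong (*-congˡ {1# + x} (ι-inverse k)))) ⟩
  (c * 1# - (1# + x) * 1#) * a
    ≈⟨ solve 2 (λ x a → (con (+ 2) :* con 1ℤ :- (con 1ℤ :+ x) :* con 1ℤ) :* a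
                  := (con 1ℤ :- x) :* a) ≈-refl x a ⟩
  (1# - x) * a
    ≈⟨ ι-inverse k ⟩
  1# ∎
  where
  open ≈-Reasoning

  c x a b : Series
  c = constant (+ 2)
  x = q^ k
  a = ι k
  b = ι (k ℕ.* 2)

  x² : q^ (k ℕ.* 2) ≈ x * x
  x² = subst (λ m → q^ m ≈ x * x) (trans (cong (k ℕ.+_) (sym (ℕ.+-identityʳ k))) (ℕ.*-comm 2 k)) (q^-+ k k)

  xxb≈1 : (1# - x * x) * b ≈ 1#
  xxb≈1 = ≈-trans (*-congʳ {b} (+-congˡ {1#} (-‿cong (≈-sym x²)))) (ι-inverse (k ℕ.* 2))

-- The n-th term of ∑ (-1)ⁿ⁻¹ q^(n(n+1)/2) (q)ₙ₋₁ (xy)ⁿ / ((xq)ₙ (yq)ₙ) at x = -1, y = -qʲ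
-- is t (n - 1) j.
t : ℕ → ℕ → Series
t zero    j = q^ (1 ℕ.+ j) * (e 1 * e (1 ℕ.+ j))
t (suc k) j = q^ (2 ℕ.+ (j ℕ.+ k)) *
              (- ((1# - q^ (1 ℕ.+ k)) * (e (2 ℕ.+ k) * e (2 ℕ.+ (j ℕ.+ k))) * t k j))

-- Replacing y by yq multiplies yⁿ by qⁿ, with n = `1 + k`, and in (yq)ₙ trades the factor 1 - yq
-- for 1 - yqⁿ⁺¹.
t-sucʳ : ∀ k j → t k (suc j) ≈ q^ (1 ℕ.+ k) * (1# + q^ (1 ℕ.+ j)) * e (2 ℕ.+ (j ℕ.+ k)) * t k j
t-sucʳ zero j rewrite ℕ.+-identityʳ j = begin
  X * y * (e 1 * e₂)
    ≈⟨ solve 4 (λ x y a b → x :* y :* (a :* b) := x :* y :* a :* b :* con 1ℤ) ≈-refl X y (e 1) e₂ ⟩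
  X * y * e 1 * e₂ * 1#
    ≈⟨ *-congˡ {X * y * e 1 * e₂} (e-inverse (1 ℕ.+ j)) ⟨
  X * y * e 1 * e₂ * ((1# + y) * e₁)
    ≈⟨ solve 5 (λ x y a b c → x :* y :* a :* b :* ((con 1ℤ :+ y) :* c)
                  := x :* con 1ℤ :* (con 1ℤ :+ y) :* b :* (y :* (a :* c))) ≈-refl X y (e 1) e₂ e₁ ⟩
  X * 1# * (1# + y) * e₂ * (y * (e 1 * e₁)) ∎
  where
  open ≈-Reasoning

  y e₁ e₂ : Series
  y  = q^ (1 ℕ.+ j)
  e₁ = e (1 ℕ.+ j)
  e₂ = e (2 ℕ.+ j)
t-sucʳ (suc k) j rewrite ℕ.+-suc j k = begin
  X * z * (- ((1# - x) * (e (2 ℕ.+ k) * e₃) * t k (suc j)))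
    ≈⟨ *-congˡ {X * z} (-‿cong (*-congˡ {(1# - x) * (e (2 ℕ.+ k) * e₃)} (t-sucʳ k j))) ⟩
  X * z * (- ((1# - x) * (e (2 ℕ.+ k) * e₃) * (x * (1# + y) * e₂ * t k j)))
    ≈⟨ solve 8 (λ q x y z a b c τ →
                  q :* z :* (:- ((con 1ℤ :- x) :* (a :* c) :* (x :* (con 1ℤ :+ y) :* b :* τ)))
                  := q :* x :* (con 1ℤ :+ y) :* c :* (z :* (:- ((con 1ℤ :- x) :* (a :* b) :* τ))))
             ≈-refl X x y z (e (2 ℕ.+ k)) e₂ e₃ (t k j) ⟩
  X * x * (1# + y) * e₃ * (z * (- ((1# - x) * (e (2 ℕ.+ k) * e₂) * t k j))) ∎
  where
  open ≈-Reasoning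

  x y z e₂ e₃ : Series
  x  = q^ (1 ℕ.+ k)
  y  = q^ (1 ℕ.+ j)
  z  = q^ (2 ℕ.+ (j ℕ.+ k))
  e₂ = e (2 ℕ.+ (j ℕ.+ k))
  e₃ = e (3 ℕ.+ (j ℕ.+ k))

-- The factor is 1 - xqⁿ at x = -1, n = `1 + k`; it cancels the last factor of (xq)ₙ in the
-- denominator.
u : ℕ → ℕ → Series
u k j = (1# + q^ (1 ℕ.+ k)) * t k j

-- The local x = `q^ (1 + k)` and y = `q^ (1 + j)` are powers of q, not the variables of the
-- generating function. With b = 1 / (1 + xy) and up to the factor `t k j`, the claim reads 1 + x(1
-- + y)b = 1 + x + xy(1 - x)b, which comes down to x(1 + xy)b = x.
t-telescope : ∀ k j → t k j + t k (suc j) ≈ u k j - u (suc k) j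
t-telescope k j = begin
  τ + t k (suc j)
    ≈⟨ +-congˡ {τ} (t-sucʳ k j) ⟩
  τ + x * (1# + y) * b * τ
    ≈⟨ solve 4 (λ x y b τ → τ :+ x :* (con 1ℤ :+ y) :* b :* τ
                  := τ :+ x :* τ :* con 1ℤ :- x :* τ :* con 1ℤ :+ x :* (con 1ℤ :+ y) :* b :* τ) ≈-refl x y b τ ⟩
  τ + x * τ * 1# - x * τ * 1# + x * (1# + y) * b * τ
    ≈⟨ +-congʳ {x * (1# + y) * b * τ} (+-congˡ {τ + x * τ * 1#} (-‿cong (*-congˡ {x * τ} be≈1))) ⟨
  τ + x * τ * 1# - x * τ * ((1# + x * y) * b) + x * (1# + y) * b * τ
    ≈⟨ solve 4 (λ x y b τ →
                  τ :+ x :* τ :* con 1ℤ :- x :* τ :* ((con 1ℤ :+ x :* y) :* b) :+ x :* (con 1ℤ :+ y) :* b :* τ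
                  := (con 1ℤ :+ x) :* τ :- (x :* y :* (:- ((con 1ℤ :- x) :* b :* τ))) :* con 1ℤ) ≈-refl x y b τ ⟩
  (1# + x) * τ - x * y * (- ((1# - x) * b * τ)) * 1#
    ≈⟨ +-congˡ {(1# + x) * τ} (-‿cong (*-congˡ {x * y * (- ((1# - x) * b * τ))} (e-inverse (2 ℕ.+ k)))) ⟨
  (1# + x) * τ - x * y * (- ((1# - x) * b * τ)) * ((1# + X * x) * a)
    ≈⟨ +-congˡ {(1# + x) * τ} (-‿cong (*-congʳ {(1# + X * x) * a} (*-congʳ { - ((1# - x) * b * τ)} z≈xy))) ⟨
  (1# + x) * τ - z * (- ((1# - x) * b * τ)) * ((1# + X * x) * a)
    ≈⟨ solve 6 (λ q x z a b τ →
                  (con 1ℤ :+ x) :* τ :- (z :* (:- ((con 1ℤ :- x) :* b :* τ))) :* ((con 1ℤ :+ q :* x) :* a)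
                  := (con 1ℤ :+ x) :* τ :- (con 1ℤ :+ q :* x) :* (z :* (:- ((con 1ℤ :- x) :* (a :* b) :* τ))))
             ≈-refl X x z a b τ ⟩
  (1# + x) * τ - (1# + X * x) * (z * (- ((1# - x) * (a * b) * τ))) ∎
  where
  open ≈-Reasoning

  x y z a b τ : Series
  x = q^ (1 ℕ.+ k)
  y = q^ (1 ℕ.+ j)
  z = q^ (2 ℕ.+ (j ℕ.+ k))
  a = e (2 ℕ.+ k)
  b = e (2 ℕ.+ (j ℕ.+ k))
  τ = t k j

  z≈xy : z ≈ x * y
  z≈xy = subst (λ m → q^ (1 ℕ.+ m) ≈ x * y) (trans (ℕ.+-suc k j) (cong suc (ℕ.+-comm k j)))
               (q^-+ (1 ℕ.+ k) (1 ℕ.+ j))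

  be≈1 : (1# + x * y) * b ≈ 1#
  be≈1 = ≈-trans (*-congʳ {b} (+-congˡ {1#} (≈-sym z≈xy))) (e-inverse (2 ℕ.+ (j ℕ.+ k)))

-- The boundary term q^(j+1) / (1 + q^(j+1)) of the telescoping, in a form that shows its
-- coefficients in positive degree to be those of `- e (1 + j)`.
u-zero : ∀ j → u 0 j ≈ 1# - e (1 ℕ.+ j)
u-zero j = begin
  (1# + q^ 1) * (y * (e 1 * b))
    ≈⟨ solve 4 (λ x y a b → (con 1ℤ :+ x) :* (y :* (a :* b)) := (con 1ℤ :+ x) :* a :* (y :* b)) ≈-refl (q^ 1) y (e 1) b ⟩
  (1# + q^ 1) * e 1 * (y * b)
    ≈⟨ *-congʳ {y * b} (e-inverse 1) ⟩
  1# * (y * b)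
    ≈⟨ solve 2 (λ y b → con 1ℤ :* (y :* b) := (con 1ℤ :+ y) :* b :- b) ≈-refl y b ⟩
  (1# + y) * b - b
    ≈⟨ +-congʳ { - b} (e-inverse (1 ℕ.+ j)) ⟩
  1# - b ∎
  where
  open ≈-Reasoning

  y b : Series
  y = q^ (1 ℕ.+ j)
  b = e (1 ℕ.+ j)

-- The power of q in front has an exponent growing with both indices. In a fixed degree this ends
-- the telescoping in `k` as well as the iteration in `j`.
t-< : ∀ k j {n} → n ℕ.< 1 ℕ.+ (j ℕ.+ k) → t k j n ≡ 0ℤ
t-< zero    j n< rewrite ℕ.+-identityʳ j = q^*-< _ n<
t-< (suc k) j n< rewrite ℕ.+-suc j k     = q^*-< _ n<

⊛-vanish : ∀ {a} f g → (∀ {n} → n ℕ.< a → g n ≡ 0ℤ) → ∀ {n} → n ℕ.< a → (f ⊛ g) n ≡ 0ℤ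
⊛-vanish f g g≡0 {zero}  n<a rewrite g≡0 n<a = ℤ.*-zeroʳ (f 0)
⊛-vanish f g g≡0 {suc n} n<a
  rewrite g≡0 n<a | ⊛-vanish (f ∘ suc) g g≡0 (ℕ.<-trans (ℕ.n<1+n n) n<a) | ℤ.*-zeroʳ (f 0) = refl

-- Finite sums and divisor counts

∑ : ℕ → (ℕ → ℤ) → ℤ
∑ zero    f = 0ℤ
∑ (suc N) f = f 0 ℤ.+ ∑ N (f ∘ suc)

∑-cong-< : ∀ N {f g : ℕ → ℤ} → (∀ {i} → i ℕ.< N → f i ≡ g i) → ∑ N f ≡ ∑ N g
∑-cong-< zero    f≡g = refl
∑-cong-< (suc N) f≡g = cong₂ ℤ._+_ (f≡g ℕ.z<s) (∑-cong-< N (λ i<N → f≡g (ℕ.s<s i<N)))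

∑-cong : ∀ N {f g : ℕ → ℤ} → (∀ i → f i ≡ g i) → ∑ N f ≡ ∑ N g
∑-cong N f≡g = ∑-cong-< N (λ {i} _ → f≡g i)

∑-+ : ∀ N f g → ∑ N (λ i → f i ℤ.+ g i) ≡ ∑ N f ℤ.+ ∑ N g
∑-+ zero    f g = refl
∑-+ (suc N) f g rewrite ∑-+ N (f ∘ suc) (g ∘ suc) = lemma (f 0) (g 0) _ _
  where
  lemma : ∀ a b x y → a ℤ.+ b ℤ.+ (x ℤ.+ y) ≡ a ℤ.+ x ℤ.+ (b ℤ.+ y)
  lemma = solve-∀

∑-* : ∀ N a f → ∑ N (λ i → a ℤ.* f i) ≡ a ℤ.* ∑ N f
∑-* zero    a f = sym (ℤ.*-zeroʳ a)
∑-* (suc N) a f rewrite ∑-* N a (f ∘ suc) = sym (ℤ.*-distribˡ-+ a (f 0) _)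

∑-zero : ∀ N {f : ℕ → ℤ} → (∀ i → f i ≡ 0ℤ) → ∑ N f ≡ 0ℤ
∑-zero zero    f≡0 = refl
∑-zero (suc N) f≡0 rewrite f≡0 0 | ∑-zero N (f≡0 ∘ suc) = refl

∑-extend : ∀ N M {f : ℕ → ℤ} → (∀ i → f (N ℕ.+ i) ≡ 0ℤ) → ∑ (N ℕ.+ M) f ≡ ∑ N f
∑-extend zero    M     f≡0 = ∑-zero M f≡0
∑-extend (suc N) M {f} f≡0 = cong (λ s → f 0 ℤ.+ s) (∑-extend N M f≡0)

∑-telescope : ∀ N (f : ℕ → ℤ) → ∑ N (λ i → f i ℤ.- f (suc i)) ≡ f 0 ℤ.- f N
∑-telescope zero    f = sym (ℤ.+-inverseʳ (f 0))
∑-telescope (suc N) f rewrite ∑-telescope N (f ∘ suc) = lemma (f 0) (f 1) (f (suc N))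
  where
  lemma : ∀ a b c → a ℤ.- b ℤ.+ (b ℤ.- c) ≡ a ℤ.- c
  lemma = solve-∀

∑-pairs : ∀ N (f : ℕ → ℤ) → ∑ (N ℕ.* 2) f ≡ ∑ N (λ i → f (i ℕ.* 2) ℤ.+ f (suc (i ℕ.* 2)))
∑-pairs zero    f = refl
∑-pairs (suc N) f rewrite ∑-pairs N (f ∘ suc ∘ suc) = sym (ℤ.+-assoc (f 0) (f 1) _)

-- The nested form f 0 - (f 1 - (f 2 - ...)) is the shape in which the iteration over `j` produces
-- the alternating sum.
∑± : ℕ → (ℕ → ℤ) → ℤ
∑± zero    f = 0ℤ
∑± (suc N) f = f 0 ℤ.- ∑± N (f ∘ suc)

∑±-cong : ∀ N {f g : ℕ → ℤ} → (∀ i → f i ≡ g i) → ∑± N f ≡ ∑± N g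
∑±-cong zero    f≡g = refl
∑±-cong (suc N) f≡g = cong₂ ℤ._-_ (f≡g 0) (∑±-cong N (f≡g ∘ suc))

∑±-∑ : ∀ N f → ∑± (N ℕ.* 2) f ≡ ∑ (N ℕ.* 2) f ℤ.- + 2 ℤ.* ∑ N (λ i → f (suc (i ℕ.* 2)))
∑±-∑ zero    f = refl
∑±-∑ (suc N) f rewrite ∑±-∑ N (f ∘ suc ∘ suc) = lemma (f 0) (f 1) _ _
  where
  lemma : ∀ a b x y → a ℤ.- (b ℤ.- (x ℤ.- + 2 ℤ.* y)) ≡ a ℤ.+ (b ℤ.+ x) ℤ.- + 2 ℤ.* (b ℤ.+ y)
  lemma = solve-∀

-- Iterating h j = g j - h (j + 1) from j = 0 leaves a remainder ± h M, which is zero.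
∑±-unfold : ∀ M (h g : ℕ → ℤ) → (∀ j → h j ℤ.+ h (suc j) ≡ g j) → h M ≡ 0ℤ → h 0 ≡ ∑± M g
∑±-unfold zero    h g step hM≡0 = hM≡0
∑±-unfold (suc M) h g step hM≡0 =
  trans (lemma (h 0) (h 1)) (cong₂ ℤ._-_ (step 0) (∑±-unfold M (h ∘ suc) (g ∘ suc) (step ∘ suc) hM≡0))
  where
  lemma : ∀ a b → a ≡ a ℤ.+ b ℤ.- b
  lemma = solve-∀

∑t≡∑±u : ∀ n N M → n ℕ.≤ N → n ℕ.≤ M → ∑ N (λ k → t k 0 n) ≡ ∑± M (λ j → u 0 j n)
∑t≡∑±u n N M n≤N n≤M = ∑±-unfold M (λ j → ∑ N (λ k → t k j n)) (λ j → u 0 j n) step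
  (∑-zero N (λ k → t-< k M (ℕ.s≤s (ℕ.≤-trans n≤M (ℕ.m≤m+n M k)))))
  where
  open ≡-Reasoning

  u≡0 : ∀ j → u N j n ≡ 0ℤ
  u≡0 j = ⊛-vanish (1# + q^ (1 ℕ.+ N)) (t N j) (t-< N j) (ℕ.s≤s (ℕ.≤-trans n≤N (ℕ.m≤n+m N j)))

  step : ∀ j → ∑ N (λ k → t k j n) ℤ.+ ∑ N (λ k → t k (suc j) n) ≡ u 0 j n
  step j = begin
    ∑ N (λ k → t k j n) ℤ.+ ∑ N (λ k → t k (suc j) n)  ≡⟨ ∑-+ N _ _ ⟨
    ∑ N (λ k → t k j n ℤ.+ t k (suc j) n)              ≡⟨ ∑-cong N (λ k → t-telescope k j n) ⟩
    ∑ N (λ k → u k j n ℤ.- u (suc k) j n)              ≡⟨ ∑-telescope N (λ k → u k j n) ⟩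
    u 0 j n ℤ.- u N j n                                ≡⟨ cong (λ s → u 0 j n ℤ.- s) (u≡0 j) ⟩
    u 0 j n ℤ.- 0ℤ                                     ≡⟨ ℤ.+-identityʳ _ ⟩
    u 0 j n                                            ∎

length-filter-applyUpTo : ∀ {P : ℕ → Set} (P? : Decidable P) (f : ℕ → ℕ) N →
  + length (filter P? (applyUpTo f N)) ≡ ∑ N (λ i → bit (does (P? (f i))))
length-filter-applyUpTo P? f zero = refl
length-filter-applyUpTo P? f (suc N) with does (P? (f 0))
... | true  = cong (λ s → 1ℤ ℤ.+ s) (length-filter-applyUpTo P? (f ∘ suc) N)
... | false = trans (length-filter-applyUpTo P? (f ∘ suc) N) (sym (ℤ.+-identityˡ _))

∑-ι-multiples : ∀ m .{{_ : NonZero m}} n .{{_ : NonZero n}} M →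
  ∑ (n ℕ.+ M) (λ i → ι (suc i ℕ.* m) n) ≡ ∑ n (λ i → ι (suc i ℕ.* m) n)
∑-ι-multiples m n M = ∑-extend n M λ i →
  ι-> n (ℕ.<-≤-trans (ℕ.s≤s (ℕ.m≤m+n n i)) (ℕ.m≤m*n (suc (n ℕ.+ i)) m))

1#≡0 : ∀ n .{{_ : NonZero n}} → 1# n ≡ 0ℤ
1#≡0 (suc _) = refl

-- Divisor counts as combinations of counts of multiples

module DivisorCount (n : ℕ) .{{_ : NonZero n}} where

  open ≡-Reasoning

  -- The number of divisors of `n` that are multiples of `m`; the values at 1, 2 and 4 are the
  -- common currency for `d`, `d24` and the alternating sum.
  multiples : ℕ → ℤ
  multiples m = ∑ n (λ i → ι (suc i ℕ.* m) n)

  extended : ∀ m .{{_ : NonZero m}} c → n ℕ.≤ c → ∑ c (λ i → ι (suc i ℕ.* m) n) ≡ multiples m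
  extended m c n≤c with ℕ.m≤n⇒∃[o]m+o≡n n≤c
  ... | M , refl = ∑-ι-multiples m n M

  d≡ : + d n ≡ multiples 1
  d≡ = trans (length-filter-applyUpTo (_∣? n) suc n)
             (∑-cong n (λ i → cong (λ k → ι k n) (sym (ℕ.*-identityʳ (suc i)))))

  n≤2n : n ℕ.≤ n ℕ.* 2
  n≤2n = ℕ.m≤m*n n 2

  n≤4n : n ℕ.≤ n ℕ.* 2 ℕ.* 2
  n≤4n = ℕ.≤-trans n≤2n (ℕ.m≤m*n (n ℕ.* 2) 2)

  χ : ℕ → ℤ
  χ k = bit (does (k ∣? n) ∧ does (k ℕ.% 4 ℕ.≟ 2))

  -- Raising `i` by two adds 4, which `_%_` by 4 discards by computation.
  odd%4≢2 : ∀ i → does (suc (i ℕ.* 2) ℕ.% 4 ℕ.≟ 2) ≡ false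
  odd%4≢2 0             = refl
  odd%4≢2 1             = refl
  odd%4≢2 (suc (suc i)) = odd%4≢2 i

  2odd%4≡2 : ∀ i → does (suc (i ℕ.* 2) ℕ.* 2 ℕ.% 4 ℕ.≟ 2) ≡ true
  2odd%4≡2 zero    = refl
  2odd%4≡2 (suc i) = 2odd%4≡2 i

  4*%4≢2 : ∀ i → does (i ℕ.* 2 ℕ.* 2 ℕ.% 4 ℕ.≟ 2) ≡ false
  4*%4≢2 zero    = refl
  4*%4≢2 (suc i) = 4*%4≢2 i

  χ-false : ∀ k → does (k ℕ.% 4 ℕ.≟ 2) ≡ false → χ k ≡ 0ℤ
  χ-false k eq rewrite eq | ∧-zeroʳ (does (k ∣? n)) = refl

  χ-true : ∀ k → does (k ℕ.% 4 ℕ.≟ 2) ≡ true → χ k ≡ ι k n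
  χ-true k eq rewrite eq | ∧-identityʳ (does (k ∣? n)) = refl

  χ-> : ∀ k → n ℕ.< k → χ k ≡ 0ℤ
  χ-> k n<k with does (k ∣? n) | ι-> {k} n n<k
  ... | false | _ = refl

  evens : ∑ (n ℕ.* 2) (λ i → ι (suc i ℕ.* 2) n) ≡ ∑ n (λ i → ι (suc (i ℕ.* 2) ℕ.* 2) n) ℤ.+ multiples 4
  evens = begin
    ∑ (n ℕ.* 2) (λ i → ι (suc i ℕ.* 2) n)
      ≡⟨ ∑-pairs n _ ⟩
    ∑ n (λ i → ι (suc (i ℕ.* 2) ℕ.* 2) n ℤ.+ ι (suc i ℕ.* 2 ℕ.* 2) n)
      ≡⟨ ∑-+ n _ _ ⟩
    ∑ n (λ i → ι (suc (i ℕ.* 2) ℕ.* 2) n) ℤ.+ ∑ n (λ i → ι (suc i ℕ.* 2 ℕ.* 2) n)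
      ≡⟨ cong (λ s → ∑ n (λ i → ι (suc (i ℕ.* 2) ℕ.* 2) n) ℤ.+ s)
              (∑-cong n (λ i → cong (λ k → ι k n) (ℕ.*-assoc (suc i) 2 2))) ⟩
    ∑ n (λ i → ι (suc (i ℕ.* 2) ℕ.* 2) n) ℤ.+ multiples 4 ∎

  d24≡ : + d24 n ≡ multiples 2 ℤ.- multiples 4
  d24≡ = begin
    + d24 n
      ≡⟨ length-filter-applyUpTo (λ k → (k ∣? n) ×-dec (k ℕ.% 4 ℕ.≟ 2)) suc n ⟩
    ∑ n (λ i → χ (suc i))
      -- A range of length 4n can be halved twice: the first halving discards the odd numbers, the
      -- second the multiples of 4.
      ≡⟨ extendχ ⟩
    ∑ (n ℕ.* 2 ℕ.* 2) (λ i → χ (suc i))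
      ≡⟨ ∑-pairs (n ℕ.* 2) (λ i → χ (suc i)) ⟩
    ∑ (n ℕ.* 2) (λ i → χ (suc (i ℕ.* 2)) ℤ.+ χ (suc i ℕ.* 2))
      ≡⟨ ∑-cong (n ℕ.* 2) (λ i → trans (cong (λ s → s ℤ.+ χ (suc i ℕ.* 2)) (χ-false (suc (i ℕ.* 2)) (odd%4≢2 i)))
                                       (ℤ.+-identityˡ (χ (suc i ℕ.* 2)))) ⟩
    ∑ (n ℕ.* 2) (λ i → χ (suc i ℕ.* 2))
      ≡⟨ ∑-pairs n (λ i → χ (suc i ℕ.* 2)) ⟩
    ∑ n (λ i → χ (suc (i ℕ.* 2) ℕ.* 2) ℤ.+ χ (suc i ℕ.* 2 ℕ.* 2))
      ≡⟨ ∑-cong n (λ i → trans (cong₂ ℤ._+_ (χ-true (suc (i ℕ.* 2) ℕ.* 2) (2odd%4≡2 i))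
                                            (χ-false (suc i ℕ.* 2 ℕ.* 2) (4*%4≢2 (suc i))))
                               (ℤ.+-identityʳ (ι (suc (i ℕ.* 2) ℕ.* 2) n))) ⟩
    ∑ n (λ i → ι (suc (i ℕ.* 2) ℕ.* 2) n)
      ≡⟨ lemma _ (multiples 4) ⟩
    ∑ n (λ i → ι (suc (i ℕ.* 2) ℕ.* 2) n) ℤ.+ multiples 4 ℤ.- multiples 4
      ≡⟨ cong (λ s → s ℤ.- multiples 4) (trans (sym evens) (extended 2 (n ℕ.* 2) n≤2n)) ⟩
    multiples 2 ℤ.- multiples 4 ∎
    where
    lemma : ∀ a b → a ≡ a ℤ.+ b ℤ.- b
    lemma = solve-∀

    extendχ : ∑ n (λ i → χ (suc i)) ≡ ∑ (n ℕ.* 2 ℕ.* 2) (λ i → χ (suc i))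
    extendχ with ℕ.m≤n⇒∃[o]m+o≡n n≤4n
    ... | M , eq = trans (sym (∑-extend n M (λ i → χ-> (suc (n ℕ.+ i)) (ℕ.s≤s (ℕ.m≤m+n n i)))))
                         (cong (λ c → ∑ c (λ i → χ (suc i))) eq)

  -- If r = `suc j` divides `n`, this value is 1 or -1 according as n / r is odd or even; otherwise
  -- it is 0.
  u≡ι : ∀ j → u 0 j n ≡ ι (suc j) n ℤ.- + 2 ℤ.* ι (suc j ℕ.* 2) n
  u≡ι j = begin
    u 0 j n            ≡⟨ u-zero j n ⟩
    1# n ℤ.- e (suc j) n ≡⟨ cong (λ s → s ℤ.- e (suc j) n) (1#≡0 n) ⟩
    0ℤ ℤ.- e (suc j) n   ≡⟨ lemma (ι (suc j ℕ.* 2) n) (ι (suc j) n) ⟩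
    ι (suc j) n ℤ.- + 2 ℤ.* ι (suc j ℕ.* 2) n ∎
    where
    lemma : ∀ a b → 0ℤ ℤ.- (a ℤ.+ a ℤ.- b) ≡ b ℤ.- + 2 ℤ.* a
    lemma = solve-∀

  ∑-combination : ∀ N (f g : ℕ → ℤ) → ∑ N (λ i → f i ℤ.- + 2 ℤ.* g i) ≡ ∑ N f ℤ.- + 2 ℤ.* ∑ N g
  ∑-combination N f g = begin
    ∑ N (λ i → f i ℤ.- + 2 ℤ.* g i)
      ≡⟨ ∑-cong N (λ i → cong (λ s → f i ℤ.+ s) (ℤ.neg-distribˡ-* (+ 2) (g i))) ⟩
    ∑ N (λ i → f i ℤ.+ ℤ.- (+ 2) ℤ.* g i)
      ≡⟨ ∑-+ N f _ ⟩
    ∑ N f ℤ.+ ∑ N (λ i → ℤ.- (+ 2) ℤ.* g i)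
      ≡⟨ cong (λ s → ∑ N f ℤ.+ s) (∑-* N (ℤ.- (+ 2)) g) ⟩
    ∑ N f ℤ.+ ℤ.- (+ 2) ℤ.* ∑ N g
      ≡⟨ cong (λ s → ∑ N f ℤ.+ s) (ℤ.neg-distribˡ-* (+ 2) (∑ N g)) ⟨
    ∑ N f ℤ.- + 2 ℤ.* ∑ N g ∎

  -- Odd indices `j` are even divisors r = j + 1. The full sum gives `multiples 1` - 2
  -- `multiples 2`; twice the part with r even, `multiples 2` - 2 `multiples 4`, is subtracted.
  ∑±u≡d : ∑± (n ℕ.* 2 ℕ.* 2) (λ j → u 0 j n) ≡ + d n ℤ.- + 4 ℤ.* + d24 n
  ∑±u≡d = begin
    ∑± (n ℕ.* 2 ℕ.* 2) (λ j → u 0 j n)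
      ≡⟨ ∑±-cong (n ℕ.* 2 ℕ.* 2) u≡ι ⟩
    ∑± (n ℕ.* 2 ℕ.* 2) (λ i → ι (suc i) n ℤ.- + 2 ℤ.* ι (suc i ℕ.* 2) n)
      ≡⟨ ∑±-∑ (n ℕ.* 2) _ ⟩
    ∑ (n ℕ.* 2 ℕ.* 2) (λ i → ι (suc i) n ℤ.- + 2 ℤ.* ι (suc i ℕ.* 2) n)
      ℤ.- + 2 ℤ.* ∑ (n ℕ.* 2) (λ i → ι (suc i ℕ.* 2) n ℤ.- + 2 ℤ.* ι (suc i ℕ.* 2 ℕ.* 2) n)
      ≡⟨ cong₂ (λ a b → a ℤ.- + 2 ℤ.* b)
           (trans (∑-combination (n ℕ.* 2 ℕ.* 2) (λ i → ι (suc i) n) (λ i → ι (suc i ℕ.* 2) n))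
                  (cong₂ (λ a b → a ℤ.- + 2 ℤ.* b)
                    (trans (∑-cong (n ℕ.* 2 ℕ.* 2) (λ i → cong (λ k → ι k n) (sym (ℕ.*-identityʳ (suc i)))))
                           (extended 1 (n ℕ.* 2 ℕ.* 2) n≤4n))
                    (extended 2 (n ℕ.* 2 ℕ.* 2) n≤4n)))
           (trans (∑-combination (n ℕ.* 2) (λ i → ι (suc i ℕ.* 2) n) (λ i → ι (suc i ℕ.* 2 ℕ.* 2) n))
                  (cong₂ (λ a b → a ℤ.- + 2 ℤ.* b)
                    (extended 2 (n ℕ.* 2) n≤2n)
                    (trans (∑-cong (n ℕ.* 2) (λ i → cong (λ k → ι k n) (ℕ.*-assoc (suc i) 2 2)))
                           (extended 4 (n ℕ.* 2) n≤2n)))) ⟩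
    multiples 1 ℤ.- + 2 ℤ.* multiples 2 ℤ.- + 2 ℤ.* (multiples 2 ℤ.- + 2 ℤ.* multiples 4)
      ≡⟨ lemma (multiples 1) (multiples 2) (multiples 4) ⟩
    multiples 1 ℤ.- + 4 ℤ.* (multiples 2 ℤ.- multiples 4)
      ≡⟨ cong₂ (λ a b → a ℤ.- + 4 ℤ.* b) d≡ d24≡ ⟨
    + d n ℤ.- + 4 ℤ.* + d24 n ∎
    where
    lemma : ∀ a b c → a ℤ.- + 2 ℤ.* b ℤ.- + 2 ℤ.* (b ℤ.- + 2 ℤ.* c) ≡ a ℤ.- + 4 ℤ.* (b ℤ.- c)
    lemma = solve-∀

-- Partitions

∑ₗ : {A : Set} → (A → ℤ) → List A → ℤ
∑ₗ g xs = sumℤ (map g xs)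

module _ {A : Set} where

  ∑ₗ-++ : ∀ (g : A → ℤ) xs ys → ∑ₗ g (xs ++ ys) ≡ ∑ₗ g xs ℤ.+ ∑ₗ g ys
  ∑ₗ-++ g []       ys = sym (ℤ.+-identityˡ _)
  ∑ₗ-++ g (x ∷ xs) ys rewrite ∑ₗ-++ g xs ys = sym (ℤ.+-assoc (g x) _ _)

  ∑ₗ-map : ∀ {B : Set} (g : A → ℤ) (f : B → A) xs → ∑ₗ g (map f xs) ≡ ∑ₗ (g ∘ f) xs
  ∑ₗ-map g f xs = cong sumℤ (sym (map-∘ xs))

  ∑ₗ-cong : ∀ {g h : A → ℤ} {xs} → All (λ x → g x ≡ h x) xs → ∑ₗ g xs ≡ ∑ₗ h xs
  ∑ₗ-cong g≡h = cong sumℤ (map-cong-local g≡h)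

  ∑ₗ-+ : ∀ (g h : A → ℤ) xs → ∑ₗ (λ x → g x ℤ.+ h x) xs ≡ ∑ₗ g xs ℤ.+ ∑ₗ h xs
  ∑ₗ-+ g h []       = refl
  ∑ₗ-+ g h (x ∷ xs) rewrite ∑ₗ-+ g h xs = lemma (g x) (h x) _ _
    where
    lemma : ∀ a b x y → a ℤ.+ b ℤ.+ (x ℤ.+ y) ≡ a ℤ.+ x ℤ.+ (b ℤ.+ y)
    lemma = solve-∀

  ∑ₗ-* : ∀ a (g : A → ℤ) xs → ∑ₗ (λ x → a ℤ.* g x) xs ≡ a ℤ.* ∑ₗ g xs
  ∑ₗ-* a g []       = sym (ℤ.*-zeroʳ a)
  ∑ₗ-* a g (x ∷ xs) rewrite ∑ₗ-* a g xs = sym (ℤ.*-distribˡ-+ a (g x) _)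

  ∑ₗ-filter : ∀ {P : A → Set} (P? : Decidable P) (g : A → ℤ) xs →
    ∑ₗ g (filter P? xs) ≡ ∑ₗ (λ x → bit (does (P? x)) ℤ.* g x) xs
  ∑ₗ-filter P? g []       = refl
  ∑ₗ-filter P? g (x ∷ xs) with does (P? x)
  ... | true  = cong₂ ℤ._+_ (sym (ℤ.*-identityˡ (g x))) (∑ₗ-filter P? g xs)
  ... | false = trans (∑ₗ-filter P? g xs) (sym (ℤ.+-identityˡ _))

  ∑ₗ-concatMap-applyUpTo : ∀ (g : A → ℤ) (h : ℕ → List A) (f : ℕ → ℕ) N →
    ∑ₗ g (concatMap h (applyUpTo f N)) ≡ ∑ N (λ i → ∑ₗ g (h (f i)))
  ∑ₗ-concatMap-applyUpTo g h f zero    = refl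
  ∑ₗ-concatMap-applyUpTo g h f (suc N) =
    trans (∑ₗ-++ g (h (f 0)) _) (cong (λ s → ∑ₗ g (h (f 0)) ℤ.+ s) (∑ₗ-concatMap-applyUpTo g h (f ∘ suc) N))

  concatMap-applyUpTo-cong : ∀ {h h′ : ℕ → List A} (f : ℕ → ℕ) N → (∀ i → h (f i) ≡ h′ (f i)) →
    concatMap h (applyUpTo f N) ≡ concatMap h′ (applyUpTo f N)
  concatMap-applyUpTo-cong f zero    h≡h′ = refl
  concatMap-applyUpTo-cong f (suc N) h≡h′ =
    cong₂ _++_ (h≡h′ 0) (concatMap-applyUpTo-cong (f ∘ suc) N (h≡h′ ∘ suc))

-- Each part consumes one unit of fuel and at least one unit of `n`. Recursions on partitions leave
-- surplus fuel, which this removes.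
partsF-fuel : ∀ f f′ k n → n ℕ.≤ f → n ℕ.≤ f′ → partsF f k n ≡ partsF f′ k n
partsF-fuel f       f′       k zero    _            _             = refl
partsF-fuel (suc f) (suc f′) k (suc n) (ℕ.s≤s n≤f) (ℕ.s≤s n≤f′) =
  concatMap-applyUpTo-cong suc (k ℕ.⊓ suc n) λ i → cong (map (suc i ∷_))
    (partsF-fuel f f′ (suc i) (n ℕ.∸ i) (ℕ.≤-trans (ℕ.m∸n≤m n i) n≤f) (ℕ.≤-trans (ℕ.m∸n≤m n i) n≤f′))

partsF-bounded : ∀ f k n → All (All (ℕ._≤ k)) (partsF f k n)
partsF-bounded f       k zero    = [] ∷ []
partsF-bounded zero    k (suc n) = []
partsF-bounded (suc f) k (suc n) =
  All.concat⁺ (All.map⁺ (All.applyUpTo⁺₁ suc (k ℕ.⊓ suc n) λ {i} i<min →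
    let i<k = ℕ.≤-trans i<min (ℕ.m⊓n≤m k (suc n)) in
    All.map⁺ (All.map (λ ρ≤ → i<k ∷ All.map (λ p≤ → ℕ.≤-trans p≤ i<k) ρ≤)
                      (partsF-bounded f (suc i) (n ℕ.∸ i)))))

parts : ℕ → ℕ → List (List ℕ)
parts k n = partsF n k n

parts-< : ∀ k n → n ℕ.< suc k → parts (suc k) n ≡ parts k n
parts-< k zero    _               = refl
parts-< k (suc n) (ℕ.s≤s n<k)
  rewrite ℕ.m≥n⇒m⊓n≡n n<k | ℕ.m≥n⇒m⊓n≡n (ℕ.≤-trans (ℕ.n≤1+n n) n<k) = refl

-- The lists are non-increasing, so `suc k` occurs exactly when it is the head, and it is the last
-- head to be enumerated.
parts-+ : ∀ k n → parts (suc k) (suc k ℕ.+ n) ≡ parts k (suc k ℕ.+ n) ++ map (suc k ∷_) (parts (suc k) n)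
parts-+ k n = begin
  concatMap h (applyUpTo suc (suc (k ℕ.⊓ (k ℕ.+ n))))
    ≡⟨ cong (λ b → concatMap h (applyUpTo suc (suc b))) (ℕ.m≤n⇒m⊓n≡m (ℕ.m≤m+n k n)) ⟩
  concatMap h (applyUpTo suc (suc k))
    ≡⟨ cong (concatMap h) (applyUpTo-∷ʳ suc k) ⟨
  concatMap h (applyUpTo suc k ∷ʳ suc k)
    ≡⟨ concatMap-++ h (applyUpTo suc k) _ ⟩
  concatMap h (applyUpTo suc k) ++ (h (suc k) ++ [])
    ≡⟨ cong₂ (λ b ys → concatMap h (applyUpTo suc b) ++ ys)
             (sym (ℕ.m≤n⇒m⊓n≡m (ℕ.≤-trans (ℕ.m≤m+n k n) (ℕ.n≤1+n _))))
             (trans (++-identityʳ (h (suc k))) (cong (map (suc k ∷_)) last)) ⟩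
  concatMap h (applyUpTo suc (k ℕ.⊓ suc (k ℕ.+ n))) ++ map (suc k ∷_) (parts (suc k) n) ∎
  where
  open ≡-Reasoning

  h : ℕ → List (List ℕ)
  h i = map (i ∷_) (partsF (k ℕ.+ n) i (suc (k ℕ.+ n) ℕ.∸ i))

  last : partsF (k ℕ.+ n) (suc k) (k ℕ.+ n ℕ.∸ k) ≡ parts (suc k) n
  last rewrite ℕ.m+n∸m≡n k n = partsF-fuel (k ℕ.+ n) n (suc k) n (ℕ.m≤n+m n k) ℕ.≤-refl

-- Multiplicities and weights

mult-∷-≡ : ∀ k ρ → mult (k ∷ ρ) k ≡ suc (mult ρ k)
mult-∷-≡ k ρ = cong length (filter-accept (k ℕ.≟_) refl)

mult-∷-≢ : ∀ {k j} ρ → ¬ j ≡ k → mult (k ∷ ρ) j ≡ mult ρ j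
mult-∷-≢ {k} {j} ρ j≢k = cong length (filter-reject (j ℕ.≟_) j≢k)

mult-∉ : ∀ {π j} → j ∉ π → mult π j ≡ 0
mult-∉ {π} {j} j∉π = cong length (filter-none (j ℕ.≟_) (All.¬Any⇒All¬ π j∉π))

mult-bounded : ∀ {k ρ} → All (ℕ._≤ k) ρ → mult ρ (suc k) ≡ 0
mult-bounded {k} ρ≤k = cong length (filter-none (suc k ℕ.≟_) (All.map (λ { p≤k refl → ℕ.1+n≰n p≤k }) ρ≤k))

largest-bounded : ∀ {k ρ} → All (ℕ._≤ k) ρ → largest ρ ℕ.≤ k
largest-bounded []           = ℕ.z≤n
largest-bounded (p≤k ∷ ρ≤k) = ℕ.⊔-lub p≤k (largest-bounded ρ≤k)

sign : List ℕ → ℤ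
sign ρ = -1ℤ ℤ.^ length ρ

-- 2ν - 1, except that it vanishes at ν = 0: this encodes the condition that every i < ℓ(π) occurs.
β : ℕ → ℤ
β zero      = 0ℤ
β ν@(suc _) = + (2 ℕ.* ν) ℤ.- + 1

productβ : List ℕ → List ℕ → ℤ
productβ π js = productℤ (map (λ j → β (mult π j)) js)

W : ℕ → List ℕ → ℤ
W k π = productβ π (range 1 k)

productℤ-∷ʳ : ∀ xs x → productℤ (xs ∷ʳ x) ≡ productℤ xs ℤ.* x
productℤ-∷ʳ []       x = ℤ.*-comm x 1ℤ
productℤ-∷ʳ (y ∷ xs) x rewrite productℤ-∷ʳ xs x = sym (ℤ.*-assoc y _ x)

W-suc : ∀ k π → W (suc k) π ≡ W k π ℤ.* β (mult π (suc k))
W-suc k π = begin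
  productℤ (map w (applyUpTo suc (suc k)))        ≡⟨ cong (λ js → productℤ (map w js)) (applyUpTo-∷ʳ suc k) ⟨
  productℤ (map w (applyUpTo suc k ∷ʳ suc k))     ≡⟨ cong productℤ (map-++ w (applyUpTo suc k) _) ⟩
  productℤ (map w (applyUpTo suc k) ∷ʳ w (suc k)) ≡⟨ productℤ-∷ʳ (map w (applyUpTo suc k)) _ ⟩
  W k π ℤ.* w (suc k)                             ∎
  where
  open ≡-Reasoning

  w : ℕ → ℤ
  w j = β (mult π j)

W-∷ : ∀ k ρ → W k (suc k ∷ ρ) ≡ W k ρ
W-∷ k ρ = cong productℤ (map-cong-local (All.applyUpTo⁺₁ suc k λ j<k →
  cong β (mult-∷-≢ {suc k} ρ (λ { refl → ℕ.n≮n _ j<k }))))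

productβ-all : ∀ {π js} → All (_∈ π) js →
  productℤ (map (λ j → + (2 ℕ.* mult π j) ℤ.- + 1) js) ≡ productβ π js
productβ-all {π} js⊆π = cong productℤ (map-cong-local (All.map (λ {j} j∈π → β-positive (filter-some (j ℕ.≟_) j∈π)) js⊆π))
  where
  β-positive : ∀ {ν} → 0 ℕ.< ν → + (2 ℕ.* ν) ℤ.- + 1 ≡ β ν
  β-positive {suc ν} _ = refl

-- A missing `j` has multiplicity 0, and `β 0` annihilates the product: the weight itself discards
-- partitions outside P*.
productβ-¬all : ∀ {π} js → ¬ All (_∈ π) js → productβ π js ≡ 0ℤ
productβ-¬all []       ¬[] = contradiction [] ¬[]
productβ-¬all {π} (j ∷ js) ¬all with j ∈? π
... | yes j∈π rewrite productβ-¬all {π} js (λ js⊆π → ¬all (j∈π ∷ js⊆π)) = ℤ.*-zeroʳ (β (mult π j))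
... | no j∉π rewrite mult-∉ j∉π = refl

-- Taking off one copy of the largest part accounts for the exponent #(π) - 1 and turns ν(ℓ(π)) into
-- one more than the multiplicity left in `ρ`.
signedWeight-∷ : ∀ k {ρ} → All (ℕ._≤ suc k) ρ →
  bit (does (isPStar? (suc k ∷ ρ))) ℤ.* signedWeight (suc k ∷ ρ)
    ≡ sign ρ ℤ.* (W k ρ ℤ.* + suc (mult ρ (suc k)))
signedWeight-∷ k {ρ} ρ≤k =
  trans (cong weight (ℕ.m≥n⇒m⊔n≡m (largest-bounded ρ≤k))) (weight-suc (all? (_∈? π) (range 1 (suc k))))
  where
  open ≡-Reasoning

  π : List ℕ
  π = suc k ∷ ρ

  lin : ℕ → ℤ
  lin j = + (2 ℕ.* mult π j) ℤ.- + 1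

  -- Abstracted over the largest part, since `largest π` equals `suc k` only propositionally.
  weight : ℕ → ℤ
  weight ℓ = bit (does (all? (_∈? π) (range 1 ℓ))) ℤ.*
             (sign ρ ℤ.* (+ mult π ℓ ℤ.* productℤ (map lin (range 1 (ℓ ℕ.∸ 1)))))

  weight-suc : (occurs : Dec (All (_∈ π) (range 1 (suc k)))) →
    bit (does occurs) ℤ.* (sign ρ ℤ.* (+ mult π (suc k) ℤ.* productℤ (map lin (range 1 k))))
      ≡ sign ρ ℤ.* (W k ρ ℤ.* + suc (mult ρ (suc k)))
  weight-suc (yes all) = begin
    1ℤ ℤ.* (sign ρ ℤ.* (+ mult π (suc k) ℤ.* productℤ (map lin (range 1 k))))
      ≡⟨ ℤ.*-identityˡ _ ⟩
    sign ρ ℤ.* (+ mult π (suc k) ℤ.* productℤ (map lin (range 1 k)))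
      ≡⟨ cong (sign ρ ℤ.*_) (cong₂ ℤ._*_ (cong +_ (mult-∷-≡ (suc k) ρ))
           (trans (productβ-all (All.applyUpTo⁺₁ suc k λ j<k → All.applyUpTo⁻ suc (suc k) all (ℕ.m<n⇒m<1+n j<k)))
                  (W-∷ k ρ))) ⟩
    sign ρ ℤ.* (+ suc (mult ρ (suc k)) ℤ.* W k ρ)
      ≡⟨ cong (sign ρ ℤ.*_) (ℤ.*-comm (+ suc (mult ρ (suc k))) (W k ρ)) ⟩
    sign ρ ℤ.* (W k ρ ℤ.* + suc (mult ρ (suc k))) ∎
  weight-suc (no ¬all) = sym (begin
    sign ρ ℤ.* (W k ρ ℤ.* + suc (mult ρ (suc k)))
      ≡⟨ cong (λ w → sign ρ ℤ.* (w ℤ.* + suc (mult ρ (suc k)))) (trans (sym (W-∷ k ρ)) (productβ-¬all (range 1 k) ¬all′)) ⟩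
    sign ρ ℤ.* 0ℤ
      ≡⟨ ℤ.*-zeroʳ (sign ρ) ⟩
    0ℤ ∎)
    where
    -- The value `suc k` is the head of `π`, so the missing part lies in 1, ..., k, where `W k`
    -- detects it.
    ¬all′ : ¬ All (_∈ π) (range 1 k)
    ¬all′ all = ¬all (subst (All (_∈ π)) (applyUpTo-∷ʳ suc k) (All.∷ʳ⁺ all (here refl)))

-- Because of β, only partitions containing all of 1, ..., k contribute to P k and to F k w; in F k w the
-- multiplicity of k + 1 is unrestricted and weighted by w.
P : ℕ → Series
P k n = ∑ₗ (λ ρ → sign ρ ℤ.* W k ρ) (parts k n)

F : ℕ → (ℕ → ℤ) → Series
F k w n = ∑ₗ (λ ρ → sign ρ ℤ.* (W k ρ ℤ.* w (mult ρ (suc k)))) (parts (suc k) n)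

P-zero : P 0 ≈ 1#
P-zero zero    = refl
P-zero (suc n) = refl

P-suc : ∀ k → P (suc k) ≈ F k β
P-suc k n = ∑ₗ-cong (All.universal (λ ρ → cong (sign ρ ℤ.*_) (W-suc k ρ)) (parts (suc k) n))

F-cong : ∀ k {w w′ : ℕ → ℤ} → (∀ ν → w ν ≡ w′ ν) → F k w ≈ F k w′
F-cong k w≡w′ n = ∑ₗ-cong (All.universal
  (λ ρ → cong (λ c → sign ρ ℤ.* (W k ρ ℤ.* c)) (w≡w′ (mult ρ (suc k)))) (parts (suc k) n))

F-+ : ∀ k (w w′ : ℕ → ℤ) → F k (λ ν → w ν ℤ.+ w′ ν) ≈ F k w + F k w′
F-+ k w w′ n = trans
  (∑ₗ-cong (All.universal (λ ρ → lemma (sign ρ) (W k ρ) (w (mult ρ (suc k))) (w′ (mult ρ (suc k)))) (parts (suc k) n)))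
  (∑ₗ-+ _ _ (parts (suc k) n))
  where
  lemma : ∀ s a b c → s ℤ.* (a ℤ.* (b ℤ.+ c)) ≡ s ℤ.* (a ℤ.* b) ℤ.+ s ℤ.* (a ℤ.* c)
  lemma = solve-∀

-- Partitions without `suc k` contribute `w 0` times `P k`. From the others one copy of `suc k` is
-- removed, which costs a factor -q^(k+1) and shifts the weight.
F-recurrence : ∀ k w → F k w ≈ constant (w 0) * P k - q^ (suc k) * F k (w ∘ suc)
F-recurrence k w n = trans (split n) (cong (λ s → s ℤ.- (q^ (suc k) * F k (w ∘ suc)) n) (sym (⊛-constantˡ (w 0) (P k) n)))
  where
  open ≡-Reasoning

  G : (ℕ → ℤ) → List ℕ → ℤ
  G w ρ = sign ρ ℤ.* (W k ρ ℤ.* w (mult ρ (suc k)))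

  without : ∀ n → ∑ₗ (G w) (parts k n) ≡ w 0 ℤ.* P k n
  without n = trans
    (∑ₗ-cong (All.map (λ {ρ} ρ≤k → trans (cong (λ ν → sign ρ ℤ.* (W k ρ ℤ.* w ν)) (mult-bounded ρ≤k))
                                         (lemma (sign ρ) (W k ρ) (w 0)))
                      (partsF-bounded n k n)))
    (∑ₗ-* (w 0) _ (parts k n))
    where
    lemma : ∀ s a b → s ℤ.* (a ℤ.* b) ≡ b ℤ.* (s ℤ.* a)
    lemma = solve-∀

  with-∷ : ∀ m → ∑ₗ (G w) (map (suc k ∷_) (parts (suc k) m)) ≡ ℤ.- F k (w ∘ suc) m
  with-∷ m = begin
    ∑ₗ (G w) (map (suc k ∷_) (parts (suc k) m))
      ≡⟨ ∑ₗ-map (G w) (suc k ∷_) (parts (suc k) m) ⟩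
    ∑ₗ (G w ∘ (suc k ∷_)) (parts (suc k) m)
      ≡⟨ ∑ₗ-cong (All.universal G-∷ (parts (suc k) m)) ⟩
    ∑ₗ (λ ρ → -1ℤ ℤ.* G (w ∘ suc) ρ) (parts (suc k) m)
      ≡⟨ ∑ₗ-* -1ℤ (G (w ∘ suc)) (parts (suc k) m) ⟩
    -1ℤ ℤ.* F k (w ∘ suc) m
      ≡⟨ ℤ.-1*i≡-i _ ⟩
    ℤ.- F k (w ∘ suc) m ∎
    where
    G-∷ : ∀ ρ → G w (suc k ∷ ρ) ≡ -1ℤ ℤ.* G (w ∘ suc) ρ
    G-∷ ρ rewrite W-∷ k ρ | mult-∷-≡ (suc k) ρ = ℤ.*-assoc -1ℤ (sign ρ) _

  split : ∀ n → F k w n ≡ w 0 ℤ.* P k n ℤ.- (q^ (suc k) * F k (w ∘ suc)) n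
  split n with n ℕ.<? suc k
  ... | yes n<k = begin
    ∑ₗ (G w) (parts (suc k) n)      ≡⟨ cong (∑ₗ (G w)) (parts-< k n n<k) ⟩
    ∑ₗ (G w) (parts k n)            ≡⟨ without n ⟩
    w 0 ℤ.* P k n                   ≡⟨ ℤ.+-identityʳ _ ⟨
    w 0 ℤ.* P k n ℤ.- 0ℤ            ≡⟨ cong (λ s → w 0 ℤ.* P k n ℤ.- s) (q^*-< (F k (w ∘ suc)) n<k) ⟨
    w 0 ℤ.* P k n ℤ.- (q^ (suc k) * F k (w ∘ suc)) n ∎
  ... | no n≮k with ℕ.m≤n⇒∃[o]m+o≡n (ℕ.≮⇒≥ n≮k)
  ...   | m , refl = begin
    ∑ₗ (G w) (parts (suc k) (suc k ℕ.+ m))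
      ≡⟨ cong (∑ₗ (G w)) (parts-+ k m) ⟩
    ∑ₗ (G w) (parts k (suc k ℕ.+ m) ++ map (suc k ∷_) (parts (suc k) m))
      ≡⟨ ∑ₗ-++ (G w) (parts k (suc k ℕ.+ m)) _ ⟩
    ∑ₗ (G w) (parts k (suc k ℕ.+ m)) ℤ.+ ∑ₗ (G w) (map (suc k ∷_) (parts (suc k) m))
      ≡⟨ cong₂ ℤ._+_ (without (suc k ℕ.+ m)) (with-∷ m) ⟩
    w 0 ℤ.* P k (suc k ℕ.+ m) ℤ.- F k (w ∘ suc) m
      ≡⟨ cong (λ s → w 0 ℤ.* P k (suc k ℕ.+ m) ℤ.- s) (q^*-+ (suc k) (F k (w ∘ suc)) m) ⟨
    w 0 ℤ.* P k (suc k ℕ.+ m) ℤ.- (q^ (suc k) * F k (w ∘ suc)) (suc k ℕ.+ m) ∎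

-- The hypothesis says (1 + qᵏ) f = a; this is how a recurrence for `F` is solved.
divide-1+q^ : ∀ k .{{_ : NonZero k}} {f a} → f ≈ a - q^ k * f → f ≈ e k * a
divide-1+q^ k {f} {a} f≈ = begin
  f                          ≈⟨ ⊛-identityˡ f ⟨
  1# * f                     ≈⟨ *-congʳ {f} (e-inverse k) ⟨
  (1# + x) * e k * f         ≈⟨ solve 3 (λ x c f → (con 1ℤ :+ x) :* c :* f := c :* (f :+ x :* f)) ≈-refl x (e k) f ⟩
  e k * (f + x * f)          ≈⟨ *-congˡ {e k} (+-congʳ {x * f} f≈) ⟩
  e k * (a - x * f + x * f)  ≈⟨ solve 3 (λ c a b → c :* (a :- b :+ b) := c :* a) ≈-refl (e k) a (x * f) ⟩
  e k * a                    ∎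
  where
  open ≈-Reasoning

  x : Series
  x = q^ k

F-1 : ∀ k → F k (const 1ℤ) ≈ e (suc k) * P k
F-1 k = divide-1+q^ (suc k) (≈-trans (F-recurrence k (const 1ℤ)) (+-congʳ { - (q^ (suc k) * F k (const 1ℤ))} (⊛-identityˡ (P k))))

-- The shifted weight is `w` plus its difference `w′`, so the recurrence becomes a linear equation
-- for `F k w` itself, with the simpler `F k w′` as a known term.
F-arithmetic : ∀ k (w w′ : ℕ → ℤ) → w 0 ≡ 1ℤ → (∀ ν → w (suc ν) ≡ w ν ℤ.+ w′ ν) →
  F k w ≈ e (suc k) * (P k - q^ (suc k) * F k w′)
F-arithmetic k w w′ w0≡1 step = divide-1+q^ (suc k) (begin
  F k w                                   ≈⟨ F-recurrence k w ⟩
  constant (w 0) * P k - x * F k (w ∘ suc) ≈⟨ +-cong first (-‿cong (*-congˡ {x} (≈-trans (F-cong k step) (F-+ k w w′)))) ⟩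
  P k - x * (F k w + F k w′)              ≈⟨ solve 4 (λ x p f g → p :- x :* (f :+ g) := p :- x :* g :- x :* f)
                                                     ≈-refl x (P k) (F k w) (F k w′) ⟩
  P k - x * F k w′ - x * F k w            ∎)
  where
  open ≈-Reasoning

  x : Series
  x = q^ (suc k)

  first : constant (w 0) * P k ≈ P k
  first rewrite w0≡1 = ⊛-identityˡ (P k)

-- The sum of (ν + 1)(-x)^ν over ν ≥ 0 is 1 / (1 + x)², here with x = q^(k+1).
F-suc : ∀ k → F k (λ ν → + suc ν) ≈ e (suc k) * e (suc k) * P k
F-suc k = begin
  F k (λ ν → + suc ν)
    ≈⟨ F-arithmetic k (λ ν → + suc ν) (const 1ℤ) refl (λ ν → cong +_ (ℕ.+-comm 1 (suc ν))) ⟩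
  c * (P k - x * F k (const 1ℤ))
    ≈⟨ *-congˡ {c} (+-cong (≈-sym (⊛-identityˡ (P k))) (-‿cong (*-congˡ {x} (F-1 k)))) ⟩
  c * (1# * P k - x * (c * P k))
    ≈⟨ *-congˡ {c} (+-congʳ { - (x * (c * P k))} (*-congʳ {P k} (e-inverse (suc k)))) ⟨
  c * ((1# + x) * c * P k - x * (c * P k))
    ≈⟨ solve 3 (λ x c p → c :* ((con 1ℤ :+ x) :* c :* p :- x :* (c :* p)) := c :* c :* p) ≈-refl x c (P k) ⟩
  c * c * P k ∎
  where
  open ≈-Reasoning

  x c : Series
  x = q^ (suc k)
  c = e (suc k)

-- The sum of (2ν + 1)(-x)^ν over ν ≥ 0 is (1 - x) / (1 + x)²; these factors 1 - x build up (q)ₙ₋₁.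
F-odd : ∀ k → F k (β ∘ suc) ≈ e (suc k) * e (suc k) * (1# - q^ (suc k)) * P k
F-odd k = begin
  F k (β ∘ suc)
    -- The difference 2 is written as 1 + 1, so that `F-+` reduces it to the constant weight 1.
    ≈⟨ F-arithmetic k (β ∘ suc) (λ _ → 1ℤ ℤ.+ 1ℤ) refl β-step ⟩
  c * (P k - x * F k (λ _ → 1ℤ ℤ.+ 1ℤ))
    ≈⟨ *-congˡ {c} (+-cong (≈-sym (⊛-identityˡ (P k)))
         (-‿cong (*-congˡ {x} (≈-trans (F-+ k (const 1ℤ) (const 1ℤ)) (+-cong (F-1 k) (F-1 k)))))) ⟩
  c * (1# * P k - x * (c * P k + c * P k))
    ≈⟨ *-congˡ {c} (+-congʳ { - (x * (c * P k + c * P k))} (*-congʳ {P k} (e-inverse (suc k)))) ⟨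
  c * ((1# + x) * c * P k - x * (c * P k + c * P k))
    ≈⟨ solve 3 (λ x c p → c :* ((con 1ℤ :+ x) :* c :* p :- x :* (c :* p :+ c :* p))
                  := c :* c :* (con 1ℤ :- x) :* p) ≈-refl x c (P k) ⟩
  c * c * (1# - x) * P k ∎
  where
  open ≈-Reasoning

  x c : Series
  x = q^ (suc k)
  c = e (suc k)

  β-step : ∀ ν → β (2 ℕ.+ ν) ≡ β (suc ν) ℤ.+ + 2
  β-step ν = trans (cong (λ c → + c ℤ.- + 1) (ℕ.*-suc 2 (suc ν))) (lemma (+ (2 ℕ.* suc ν)))
    where
    lemma : ∀ a → + 2 ℤ.+ a ℤ.- + 1 ≡ a ℤ.- + 1 ℤ.+ + 2
    lemma = solve-∀

-- Since `β 0` is 0, the part `suc k` must occur; splitting off one copy leaves the odd weights 2ν +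
-- 1.
P-recurrence : ∀ k → P (suc k) ≈ - (q^ (suc k) * (e (suc k) * e (suc k) * (1# - q^ (suc k)) * P k))
P-recurrence k = begin
  P (suc k)                                            ≈⟨ P-suc k ⟩
  F k β                                                ≈⟨ F-recurrence k β ⟩
  constant 0ℤ * P k - q^ (suc k) * F k (β ∘ suc)       ≈⟨ +-cong (⊛-constantˡ 0ℤ (P k)) (-‿cong (*-congˡ {q^ (suc k)} (F-odd k))) ⟩
  (λ _ → 0ℤ) - q^ (suc k) * (e (suc k) * e (suc k) * (1# - q^ (suc k)) * P k) ≈⟨ (λ n → ℤ.+-identityˡ _) ⟩
  - (q^ (suc k) * (e (suc k) * e (suc k) * (1# - q^ (suc k)) * P k)) ∎
  where open ≈-Reasoning

-- The prefactor restores the copy of the largest part `suc k` that was taken off; the recurrence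
-- for `P` then matches the recursion of `t` at j = 0.
q^*F-suc : ∀ k → q^ (suc k) * F k (λ ν → + suc ν) ≈ t k 0
q^*F-suc k = ≈-trans (*-congˡ {q^ (suc k)} (F-suc k)) (closed k)
  where
  open ≈-Reasoning

  closed : ∀ k → q^ (suc k) * (e (suc k) * e (suc k) * P k) ≈ t k 0
  closed zero = *-congˡ {q^ 1} (begin
    e 1 * e 1 * P 0   ≈⟨ *-congˡ {e 1 * e 1} P-zero ⟩
    e 1 * e 1 * 1#    ≈⟨ solve 1 (λ c → c :* con 1ℤ := c) ≈-refl (e 1 * e 1) ⟩
    e 1 * e 1         ∎)
  closed (suc k) = *-congˡ {q^ (2 ℕ.+ k)} (begin
    e₂ * e₂ * P (suc k)
      ≈⟨ *-congˡ {e₂ * e₂} (P-recurrence k) ⟩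
    e₂ * e₂ * (- (x * (e₁ * e₁ * (1# - x) * P k)))
      ≈⟨ solve 4 (λ x a b p → b :* b :* (:- (x :* (a :* a :* (con 1ℤ :- x) :* p)))
                    := :- ((con 1ℤ :- x) :* (b :* b) :* (x :* (a :* a :* p)))) ≈-refl x e₁ e₂ (P k) ⟩
    - ((1# - x) * (e₂ * e₂) * (x * (e₁ * e₁ * P k)))
      ≈⟨ -‿cong (*-congˡ {(1# - x) * (e₂ * e₂)} (closed k)) ⟩
    - ((1# - x) * (e₂ * e₂) * t k 0) ∎)
    where
    x e₁ e₂ : Series
    x  = q^ (suc k)
    e₁ = e (suc k)
    e₂ = e (2 ℕ.+ k)

-- A partition of a positive number is enumerated by its head, which is its largest part: largest
-- part `suc k` yields the term `t k 0`.
∑signedWeight : ∀ n .{{_ : NonZero n}} → sumℤ (map signedWeight (pStar n)) ≡ ∑ n (λ k → t k 0 n)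
∑signedWeight (suc m) = begin
  ∑ₗ signedWeight (pStar (suc m))
    ≡⟨ ∑ₗ-filter isPStar? signedWeight (partitions (suc m)) ⟩
  ∑ₗ g (concatMap h (applyUpTo suc (suc (m ℕ.⊓ m))))
    ≡⟨ cong (λ b → ∑ₗ g (concatMap h (applyUpTo suc (suc b)))) (ℕ.⊓-idem m) ⟩
  ∑ₗ g (concatMap h (applyUpTo suc (suc m)))
    ≡⟨ ∑ₗ-concatMap-applyUpTo g h suc (suc m) ⟩
  ∑ (suc m) (λ k → ∑ₗ g (h (suc k)))
    ≡⟨ ∑-cong-< (suc m) (λ {k} k<1+m → largest-part k (ℕ.s≤s⁻¹ k<1+m)) ⟩
  ∑ (suc m) (λ k → t k 0 (suc m)) ∎
  where
  open ≡-Reasoning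

  g : List ℕ → ℤ
  g π = bit (does (isPStar? π)) ℤ.* signedWeight π

  h : ℕ → List (List ℕ)
  h k = map (k ∷_) (partsF m k (suc m ℕ.∸ k))

  largest-part : ∀ k → k ℕ.≤ m → ∑ₗ g (h (suc k)) ≡ t k 0 (suc m)
  largest-part k k≤m = begin
    ∑ₗ g (map (suc k ∷_) (partsF m (suc k) (m ℕ.∸ k)))
      ≡⟨ ∑ₗ-map g (suc k ∷_) (partsF m (suc k) (m ℕ.∸ k)) ⟩
    ∑ₗ (g ∘ (suc k ∷_)) (partsF m (suc k) (m ℕ.∸ k))
      ≡⟨ ∑ₗ-cong (All.map (signedWeight-∷ k) (partsF-bounded m (suc k) (m ℕ.∸ k))) ⟩
    ∑ₗ (λ ρ → sign ρ ℤ.* (W k ρ ℤ.* + suc (mult ρ (suc k)))) (partsF m (suc k) (m ℕ.∸ k))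
      ≡⟨ cong (∑ₗ _) (partsF-fuel m (m ℕ.∸ k) (suc k) (m ℕ.∸ k) (ℕ.m∸n≤m m k) ℕ.≤-refl) ⟩
    F k (λ ν → + suc ν) (m ℕ.∸ k)
      ≡⟨ q^*-+ (suc k) (F k (λ ν → + suc ν)) (m ℕ.∸ k) ⟨
    (q^ (suc k) * F k (λ ν → + suc ν)) (suc k ℕ.+ (m ℕ.∸ k))
      ≡⟨ cong (λ i → (q^ (suc k) * F k (λ ν → + suc ν)) (suc i)) (ℕ.m+[n∸m]≡n k≤m) ⟩
    (q^ (suc k) * F k (λ ν → + suc ν)) (suc m)
      ≡⟨ q^*F-suc k (suc m) ⟩
    t k 0 (suc m) ∎

theorem2p6 : (n : ℕ) → .{{_ : NonZero n}} →
    (+ d n) ℤ.- (+ 4) ℤ.* (+ d24 n) ≡ sumℤ (map signedWeight (pStar n))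
theorem2p6 n = sym (begin
  sumℤ (map signedWeight (pStar n))   ≡⟨ ∑signedWeight n ⟩
  -- In degree `n`, `n` terms in `k` and 4n steps in `j` reach beyond every nonzero `t k j`; 4n is
  -- the length for which the alternating sum is evaluated.
  ∑ n (λ k → t k 0 n)                 ≡⟨ ∑t≡∑±u n n (n ℕ.* 2 ℕ.* 2) ℕ.≤-refl n≤4n ⟩
  ∑± (n ℕ.* 2 ℕ.* 2) (λ j → u 0 j n)  ≡⟨ ∑±u≡d ⟩
  + d n ℤ.- + 4 ℤ.* + d24 n           ∎)
  where
  open ≡-Reasoning
  open DivisorCount n
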